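{- Let $\mathscr{K}$ be a class of algebras of the same signature that is closed under taking homomorphic images and has definable completely meet irreducible congruences. Then there is a first order query $\phi(x,y)$ with two free variables $x,y$ such that for every $\mathbf{A}\in\mathscr{K}$ and every $a\neq b$ in $A$, the query $\phi(a,b)$ defines a subdirectly irreducible quotient of $\mathbf{A}$ in which the monolith is generated by representatives of the congruence classes of $a$ and $b$.
   Context: A class $\mathscr{K}$ of algebras of the same signature has definable completely meet irreducible congruences if there is a formula $\pi_{x,y}(u,v)$ with four free variables $x,y,u,v$ such that for every $\mathbf{A}\in\mathscr{K}$ and every $a,b\in A$ with $a\neq b$, the binary relation $\{(c,d)\in A^2\mid \mathbf{A}\models\pi_{a,b}(c,d)\}$ is a congruence of $\mathbf{A}$ that is maximal with respect to not containing the pair $(a,b)$. An algebra is subdirectly irreducible if it has a unique minimum nontrivial congruence, called its monolith. First order queries. Queries are formulated for relational signatures; every operation of arity $n$ is considered as a relation of arity $n+1$ using its graph. Formulas are allowed recourse to a strict linear order $<$ on the universe. For purely relational signatures $\mathcal{R}$ and $\mathcal{S}$, an $n$-ary first order query is a family consisting of a first order formula $\varphi(\vec{x})$ in the signature $\mathcal{R}\cup\{<\}$, where $\vec{x}=x_0,\dots,x_{n-1}$, and, for each $s\in\mathcal{S}$ of arity $k$, a first order formula $\psi_s(\vec{x}_1,\dots,\vec{x}_k)$ in the signature $\mathcal{R}\cup\{<\}$, where each $\vec{x}_i$ is an $n$-tuple of variables. On any $\mathcal{R}\cup\{<\}$-structure $\mathbb{B}$ with universe $B$ it defines the $\mathcal{S}$-structure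 whose universe is the solution set $U\subseteq B^n$ of $\varphi(\vec{x})$ and in which each $s\in\mathcal{S}$ is the restriction to $U$ of the solution set of $\psi_s$. A first order query with free variables $y_1,\dots,y_k$ is such a family in which all formulas may contain the additional free variables $y_1,\dots,y_k$; each evaluation $(y_1,\dots,y_k)\mapsto(a_1,\dots,a_k)$ in a structure gives rise to a first order query with parameters $a_1,\dots,a_k$. In the claim, $\mathcal{R}=\mathcal{S}$ is the signature of $\mathscr{K}$ (with operations replaced by their graphs), and $\phi(a,b)$ is the query obtained by evaluating $(x,y)\mapsto(a,b)$.
   Formalization: The strict linear order available to the query is required to be well founded (automatic on finite universes); with arbitrary linear orders on infinite universes the claim fails, e.g. for d(x,y,z)=z if x,y share the first coordinate, else x, on ℚ×ℝ ordered lexicographically. -}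

module Defs where

open import Data.Empty.Polymorphic using (⊥)
open import Data.Fin.Base using (Fin; zero; suc; quotRem)
open import Data.Fin.Induction using (spo-wellFounded)
open import Data.Nat.Base using (ℕ; suc; _+_; _*_)
open import Data.Product.Base as Prod using (Σ; Σ-syntax; ∃₂; _×_; _,_; proj₁; proj₂)
open import Data.Sum.Base as Sum using (_⊎_)
open import Data.Vec.Functional using (Vector; []; _∷_; _++_; concat; init; last)
import Data.Vec.Functional.Relation.Binary.Equality.Setoid as Pointwise
import Data.Vec.Functional.Relation.Binary.Pointwise.Properties as PW
open import Function.Base using (_∘_)
open import Function.Bundles using (Bijection; Inverse; _⇔_)
open import Function.Definitions using (Surjective)
open import Induction.WellFounded using (WellFounded; module Subrelation)
open import Level using (Level; _⊔_)
open import Relation.Binary.Bundles using (Setoid)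
open import Relation.Binary.Core using (Rel; _⇒_)
import Relation.Binary.Construct.On as On
open import Relation.Binary.PropositionalEquality as ≡ using (_≡_)
open import Relation.Binary.Structures using (IsEquivalence; IsStrictTotalOrder; IsStrictPartialOrder)
open import Relation.Nullary.Negation using (¬_)
open import Relation.Unary using (Pred)

private
  variable
    ℓ κ : Level
    n   : ℕ

-- Used both for operation symbols and for relation symbols.
record Signature (ℓ : Level) : Set (Level.suc ℓ) where
  field
    Symbol : Set ℓ
    arity  : Symbol → ℕ

open Signature public

∅ : Signature ℓ
∅ = record { Symbol = ⊥ ; arity = λ () }

data Term (F : Signature ℓ) (n : ℕ) : Set ℓ where
  var : Fin n → Term F n
  app : (f : Symbol F) → Vector (Term F n) (arity F f) → Term F n

infix  8 _≐_
infixr 7 _∧′_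
infixr 6 _∨′_
infixr 5 _⇒′_

-- Formulas with free variables in Fin n, over operation symbols F and
-- relation symbols R; a quantifier binds variable zero.
data Formula (F R : Signature ℓ) (n : ℕ) : Set ℓ where
  _≐_            : Term F n → Term F n → Formula F R n
  rel            : (r : Symbol R) → Vector (Term F n) (arity R r) → Formula F R n
  ⊥′             : Formula F R n
  _∧′_ _∨′_ _⇒′_ : Formula F R n → Formula F R n → Formula F R n
  ∀′ ∃′          : Formula F R (suc n) → Formula F R n

-- The universe is a setoid, whose equality interprets _≐_.  This is what
-- makes quotients available.
record Structure (F R : Signature ℓ) : Set (Level.suc ℓ) where
  field
    setoid : Setoid ℓ ℓ

  open Setoid setoid public
  open Pointwise setoid public using (_≋_; ≋-refl; ≋-sym; ≋-isEquivalence)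

  field
    ⟦_⟧ᶠ   : (f : Symbol F) → Vector Carrier (arity F f) → Carrier
    ⟦_⟧ʳ   : (r : Symbol R) → Vector Carrier (arity R r) → Set ℓ
    fcong  : ∀ f {xs ys} → xs ≋ ys → ⟦ f ⟧ᶠ xs ≈ ⟦ f ⟧ᶠ ys
    rcong  : ∀ r {xs ys} → xs ≋ ys → ⟦ r ⟧ʳ xs → ⟦ r ⟧ʳ ys

open Structure using (Carrier)

Algebra : Signature ℓ → Set (Level.suc ℓ)
Algebra F = Structure F ∅

RelStructure : Signature ℓ → Set (Level.suc ℓ)
RelStructure R = Structure ∅ R

module _ {F R : Signature ℓ} where

  eval : (A : Structure F R) → Term F n → Vector (Carrier A) n → Carrier A
  eval A (var i)    ρ = ρ i
  eval A (app f ts) ρ = Structure.⟦_⟧ᶠ A f (λ i → eval A (ts i) ρ)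

  infix 4 _⊨_[_]

  _⊨_[_] : (A : Structure F R) → Formula F R n → Vector (Carrier A) n → Set ℓ
  A ⊨ s ≐ t    [ ρ ] = Structure._≈_ A (eval A s ρ) (eval A t ρ)
  A ⊨ rel r ts [ ρ ] = Structure.⟦_⟧ʳ A r (λ i → eval A (ts i) ρ)
  A ⊨ ⊥′       [ ρ ] = ⊥
  A ⊨ φ ∧′ ψ   [ ρ ] = (A ⊨ φ [ ρ ]) × (A ⊨ ψ [ ρ ])
  A ⊨ φ ∨′ ψ   [ ρ ] = (A ⊨ φ [ ρ ]) ⊎ (A ⊨ ψ [ ρ ])
  A ⊨ φ ⇒′ ψ   [ ρ ] = A ⊨ φ [ ρ ] → A ⊨ ψ [ ρ ]
  A ⊨ ∀′ φ     [ ρ ] = ∀ x → A ⊨ φ [ x ∷ ρ ]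
  A ⊨ ∃′ φ     [ ρ ] = Σ[ x ∈ Carrier A ] A ⊨ φ [ x ∷ ρ ]

module _ {F R : Signature ℓ} (A : Structure F R) where
  open Structure A hiding (Carrier)

  eval-cong : (t : Term F n) {ρ σ : Vector (Carrier A) n} → ρ ≋ σ → eval A t ρ ≈ eval A t σ
  eval-cong (var i)    e = e i
  eval-cong (app f ts) e = fcong f (λ i → eval-cong (ts i) e)

  ∷-cong : (x : Carrier A) {ρ σ : Vector (Carrier A) n} → ρ ≋ σ → (x ∷ ρ) ≋ (x ∷ σ)
  ∷-cong x e zero    = refl
  ∷-cong x e (suc i) = e i

  ⊨-resp-≋ : (φ : Formula F R n) {ρ σ : Vector (Carrier A) n} →
             ρ ≋ σ → A ⊨ φ [ ρ ] → A ⊨ φ [ σ ]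
  ⊨-resp-≋ (s ≐ t)    e = λ p → trans (sym (eval-cong s e)) (trans p (eval-cong t e))
  ⊨-resp-≋ (rel r ts) e = rcong r (λ i → eval-cong (ts i) e)
  ⊨-resp-≋ (φ ∧′ ψ)   e = Prod.map (⊨-resp-≋ φ e) (⊨-resp-≋ ψ e)
  ⊨-resp-≋ (φ ∨′ ψ)   e = Sum.map (⊨-resp-≋ φ e) (⊨-resp-≋ ψ e)
  ⊨-resp-≋ (φ ⇒′ ψ)   e = λ h → ⊨-resp-≋ ψ e ∘ h ∘ ⊨-resp-≋ φ (≋-sym e)
  ⊨-resp-≋ (∀′ φ)     e = λ h x → ⊨-resp-≋ φ (∷-cong x e) (h x)
  ⊨-resp-≋ (∃′ φ)     e = λ (x , p) → x , ⊨-resp-≋ φ (∷-cong x e) p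

module _ {F : Signature ℓ} where

  record IsHomomorphism (A B : Algebra F) (h : Carrier A → Carrier B) : Set ℓ where
    private
      module A = Structure A
      module B = Structure B
    field
      cong : ∀ {x y} → x A.≈ y → h x B.≈ h y
      homo : ∀ f xs → h (A.⟦ f ⟧ᶠ xs) B.≈ B.⟦ f ⟧ᶠ (h ∘ xs)

  ClosedUnderHomomorphicImages : Pred (Algebra F) κ → Set (Level.suc ℓ ⊔ κ)
  ClosedUnderHomomorphicImages K =
    ∀ A B (h : Carrier A → Carrier B) → IsHomomorphism A B h →
    Surjective (Structure._≈_ A) (Structure._≈_ B) h → K A → K B

  module _ (A : Algebra F) where
    open Structure A using (_≈_; ⟦_⟧ᶠ)

    record IsCongruence (θ : Rel (Carrier A) ℓ) : Set ℓ where
      field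
        isEquivalence : IsEquivalence θ
        reflexive     : _≈_ ⇒ θ
        compatible    : ∀ f {xs ys} → (∀ i → θ (xs i) (ys i)) → θ (⟦ f ⟧ᶠ xs) (⟦ f ⟧ᶠ ys)

    record IsMaximalAvoiding (a b : Carrier A) (θ : Rel (Carrier A) ℓ) : Set (Level.suc ℓ) where
      field
        isCongruence : IsCongruence θ
        avoids       : ¬ θ a b
        maximal      : ∀ ψ → IsCongruence ψ → ¬ ψ a b → θ ⇒ ψ → ψ ⇒ θ

    Nontrivial : Rel (Carrier A) ℓ → Set ℓ
    Nontrivial θ = ∃₂ λ x y → θ x y × ¬ (x ≈ y)

    -- Least elements are unique, so a monolith is unique up to mutual
    -- inclusion.
    record IsMonolith (μ : Rel (Carrier A) ℓ) : Set (Level.suc ℓ) where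
      field
        isCongruence : IsCongruence μ
        nontrivial   : Nontrivial μ
        minimum      : ∀ ψ → IsCongruence ψ → Nontrivial ψ → μ ⇒ ψ

    SubdirectlyIrreducible : Set (Level.suc ℓ)
    SubdirectlyIrreducible = Σ (Rel (Carrier A) ℓ) IsMonolith

    monolith : SubdirectlyIrreducible → Rel (Carrier A) ℓ
    monolith = proj₁

    record IsGeneratedBy (a b : Carrier A) (μ : Rel (Carrier A) ℓ) : Set (Level.suc ℓ) where
      field
        isCongruence : IsCongruence μ
        contains     : μ a b
        least        : ∀ ψ → IsCongruence ψ → ψ a b → μ ⇒ ψ

  -- The carrier of A / θ is that of A, so that c : Carrier A stands for its
  -- own congruence class.
  infixl 7 _/_

  _/_ : (A : Algebra F) {θ : Rel (Carrier A) ℓ} → IsCongruence A θ → Algebra F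
  A / c = record
    { setoid = record { isEquivalence = IsCongruence.isEquivalence c }
    ; ⟦_⟧ᶠ   = Structure.⟦_⟧ᶠ A
    ; ⟦_⟧ʳ   = λ ()
    ; fcong  = IsCongruence.compatible c
    ; rcong  = λ ()
    }

  HasDefinableCMICongruences : Pred (Algebra F) κ → Set (Level.suc ℓ ⊔ κ)
  HasDefinableCMICongruences K =
    Σ[ π ∈ Formula F ∅ 4 ] ∀ A → K A → ∀ a b → ¬ Structure._≈_ A a b →
    IsMaximalAvoiding A a b (λ c d → A ⊨ π [ a ∷ b ∷ c ∷ d ∷ [] ])

graphs : Signature ℓ → Signature ℓ
graphs F = record { Symbol = Symbol F ; arity = suc ∘ arity F }

graph : {F : Signature ℓ} → Algebra F → RelStructure (graphs F)
graph A = record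
  { setoid = setoid
  ; ⟦_⟧ᶠ   = λ ()
  ; ⟦_⟧ʳ   = λ f xs → ⟦ f ⟧ᶠ (init xs) ≈ last xs
  ; fcong  = λ ()
  ; rcong  = λ f e p → trans (sym (fcong f (λ i → e _))) (trans p (e _))
  }
  where open Structure A

data OrderedSymbol (R : Signature ℓ) : Set ℓ where
  base : Symbol R → OrderedSymbol R
  less : OrderedSymbol R

infix 9 _∪<

_∪< : Signature ℓ → Signature ℓ
R ∪< = record { Symbol = OrderedSymbol R ; arity = λ { (base r) → arity R r ; less → 2 } }

-- On a finite universe every strict linear order is well founded (see
-- finite⇒wellFounded).  On infinite universes well-foundedness is needed for
-- queries to define quotients.  Let d(x,y,z) = z if x and y have the same
-- first coordinate and x otherwise, on ℚ × ℝ ordered lexicographically.  The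
-- quotient by equality of first coordinates is countably infinite, whereas
-- any set of tuples definable from two parameters is finite or uncountable.
record WellOrder (S : Setoid ℓ ℓ) : Set (Level.suc ℓ) where
  open Setoid S using (_≈_) renaming (Carrier to X)
  field
    _<_                : Rel X ℓ
    isStrictTotalOrder : IsStrictTotalOrder _≈_ _<_
    wellFounded        : WellFounded _<_

  open IsStrictTotalOrder isStrictTotalOrder public using (<-resp-≈)

finite⇒wellFounded : (S : Setoid ℓ ℓ) → Inverse S (≡.setoid (Fin n)) →
                     {_<_ : Rel (Setoid.Carrier S) ℓ} →
                     IsStrictTotalOrder (Setoid._≈_ S) _<_ → WellFounded _<_
finite⇒wellFounded {n = n} S S↔Fin {_<_} sto =
  Subrelation.wellFounded pull (On.wellFounded to (spo-wellFounded ⊏-isSPO))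
  where
  open Setoid S using () renaming (sym to ≈-sym; refl to ≈-refl)
  open Inverse S↔Fin using (to; from; strictlyInverseʳ)
  open IsStrictTotalOrder sto

  _⊏_ : Rel (Fin n) _
  i ⊏ j = from i < from j

  ⊏-isSPO : IsStrictPartialOrder _≡_ _⊏_
  ⊏-isSPO = record
    { isEquivalence = ≡.isEquivalence
    ; irrefl        = λ { ≡.refl → irrefl ≈-refl }
    ; trans         = trans
    ; <-resp-≈      = ≡.resp₂ _⊏_
    }

  pull : ∀ {x y} → x < y → to x ⊏ to y
  pull {x} {y} x<y = proj₁ <-resp-≈ (≈-sym (strictlyInverseʳ y))
                       (proj₂ <-resp-≈ (≈-sym (strictlyInverseʳ x)) x<y)

infix 9 _⟨_⟩

_⟨_⟩ : {R : Signature ℓ} (A : RelStructure R) → WellOrder (Structure.setoid A) →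
       RelStructure (R ∪<)
A ⟨ W ⟩ = record
  { setoid = setoid
  ; ⟦_⟧ᶠ   = λ ()
  ; ⟦_⟧ʳ   = λ { (base r) xs → ⟦ r ⟧ʳ xs
               ; less    xs → xs zero < xs (suc zero) }
  ; fcong  = λ ()
  ; rcong  = λ { (base r) e p → rcong r e p
               ; less    e p → proj₁ <-resp-≈ (e (suc zero))
                                 (proj₂ <-resp-≈ (e zero) p) }
  }
  where
  open Structure A
  open WellOrder W

-- In both kinds of formula the first k variables are the free variables of
-- the query; they are followed by one block of dim variables in universe,
-- and by arity s such blocks in relation s.
record Query (R S : Signature ℓ) (k : ℕ) : Set ℓ where
  field
    dim      : ℕ
    universe : Formula ∅ (R ∪<) (k + dim)
    relation : (s : Symbol S) → Formula ∅ (R ∪<) (k + arity S s * dim)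

module _ {R S : Signature ℓ} {k : ℕ} (q : Query R S k)
         (B : RelStructure (R ∪<)) (as : Vector (Carrier B) k) where
  open Query q
  open Structure B hiding (Carrier)

  Solution : Set ℓ
  Solution = Σ[ xs ∈ Vector (Carrier B) dim ] B ⊨ universe [ as ++ xs ]

  definedStructure : RelStructure S
  definedStructure = record
    { setoid = record
      { Carrier       = Solution
      ; _≈_           = λ u v → proj₁ u ≋ proj₁ v
      ; isEquivalence = On.isEquivalence proj₁ (≋-isEquivalence dim)
      }
    ; ⟦_⟧ᶠ   = λ ()
    ; ⟦_⟧ʳ   = λ s us → B ⊨ relation s [ as ++ concat (proj₁ ∘ us) ]
    ; fcong  = λ ()
    ; rcong  = λ s e → ⊨-resp-≋ B (relation s)
                 (PW.++⁺ _≈_ (≋-refl {x = as})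
                   (λ i → e (proj₂ (quotRem dim i)) (proj₁ (quotRem {arity S s} dim i))))
    }

infix 4 _≅_

record _≅_ {R : Signature ℓ} (A B : RelStructure R) : Set ℓ where
  private
    module A = Structure A
    module B = Structure B
  field
    bijection : Bijection A.setoid B.setoid

  open Bijection bijection public using (to)

  field
    preserves : ∀ r xs → A.⟦ r ⟧ʳ xs ⇔ B.⟦ r ⟧ʳ (to ∘ xs)

-- A query defines an algebra up to isomorphism: Q is identified with the
-- relational structure of the graphs of its operations.
Defines : {F : Signature ℓ} {k : ℕ} → Query (graphs F) (graphs F) k →
          (A : Algebra F) → WellOrder (Structure.setoid A) → Vector (Carrier A) k →
          Algebra F → Set ℓ
Defines q A W as Q = graph Q ≅ definedStructure q (graph A ⟨ W ⟩) as

-- A congruence θ that is maximal among those avoiding (a , b) has an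
-- irreducible quotient: every strictly larger congruence contains (a , b), so
-- the congruence of A / θ generated by (a , b) is least among the nontrivial
-- ones.  The quotient is definable because each θ-class has a least element
-- for the well-order: the universe of the query consists of these least
-- elements, and f(x₁,…,xₙ) = y is interpreted as "f(x₁,…,xₙ) θ y".  Nested
-- terms in the formula defining θ are flattened with existential quantifiers,
-- one for the value of each subterm.
module Submission where

open import Defs
open import Axiom.ExcludedMiddle using (ExcludedMiddle)
open import Data.Empty.Polymorphic using (⊥-elim)
open import Data.Fin.Base using (Fin; zero; suc; inject₁; fromℕ; splitAt; combine; _↑ˡ_; _↑ʳ_)
open import Data.Fin.Properties using (remQuot-combine)
open import Data.Nat.Base using (ℕ; zero; suc; _+_; _*_)
open import Data.Product.Base as Prod using (Σ-syntax; _×_; _,_; proj₁; proj₂)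
open import Data.Product.Function.NonDependent.Propositional using (_×-⇔_)
open import Data.Sum.Function.Propositional using (_⊎-⇔_)
open import Data.Sum.Properties using ([,]-map)
open import Data.Vec.Functional using (Vector; []; _∷_; _++_; head; tail; concat; insertAt)
open import Data.Vec.Functional.Properties using (insertAt-lookup; lookup-++ˡ; lookup-++ʳ)
open import Function.Base using (_∘_; id)
open import Function.Bundles using (Equivalence; _⇔_; mk⇔)
open import Function.Related.TypeIsomorphisms using (→-cong-⇔)
open import Induction.WellFounded using (module All)
open import Level using (Level)
open import Relation.Binary.Bundles using (Setoid)
open import Relation.Binary.Core using (Rel; _⇒_)
open import Relation.Binary.Definitions using (tri<; tri≈; tri>)
open import Relation.Binary.PropositionalEquality as ≡ using (_≡_)
open import Relation.Binary.Structures using (IsEquivalence; IsStrictTotalOrder)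
open import Relation.Nullary.Decidable.Core using (yes; no; decidable-stable)
open import Relation.Nullary.Negation using (¬_; contradiction)
open import Relation.Unary using (Pred)

open Equivalence using (to; from)
open Structure using (Carrier)

private
  variable
    ℓ   : Level
    X   : Set ℓ
    m n : ℕ

-- Lookups in vectors.

insertAt-inject₁ : (xs : Vector X n) (x : X) (i : Fin n) →
                   insertAt xs (fromℕ n) x (inject₁ i) ≡ xs i
insertAt-inject₁ xs x zero    = ≡.refl
insertAt-inject₁ xs x (suc i) = insertAt-inject₁ (tail xs) x i

-- At a successor, `splitAt` maps over its recursive result, so the two sides do not agree by
-- computation. The lemma splits off the variable of one quantifier in `⊨-∃*`.
++-head-tail : (xs : Vector X (suc m)) (ys : Vector X n) (i : Fin (suc m + n)) →
               (xs ++ ys) i ≡ (head xs ∷ (tail xs ++ ys)) i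
++-head-tail         xs ys zero    = ≡.refl
++-head-tail {m = m} xs ys (suc i) = [,]-map (splitAt m i)

lookup-concat : (xss : Vector (Vector X m) n) (i : Fin n) (j : Fin m) →
                concat xss (combine i j) ≡ xss i j
lookup-concat xss i j = ≡.cong (λ (i′ , j′) → xss i′ j′) (remQuot-combine i j)

-- Least representatives of equivalence classes.

module _ (em : ExcludedMiddle ℓ) {S : Setoid ℓ ℓ} (W : WellOrder S)
         {θ : Rel (Setoid.Carrier S) ℓ} (θ-isEquivalence : IsEquivalence θ) where
  open Setoid S using (_≈_) renaming (Carrier to C)
  open WellOrder W
  open IsStrictTotalOrder isStrictTotalOrder using (compare)
  private
    module θ = IsEquivalence θ-isEquivalence

  -- This form matches the formula `universe` of `leastRepresentatives`.
  LeastInClass : C → Set ℓ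
  LeastInClass x = ∀ y → y < x → ¬ θ y x

  -- Well-founded induction: if `x` has a smaller related element, the representative of that
  -- element also serves `x`; otherwise `x` itself is least. Excluded middle separates the cases.
  leastRepresentative : ∀ x → Σ[ y ∈ C ] θ x y × LeastInClass y
  leastRepresentative = All.wfRec wellFounded ℓ _ step
    where
    step : ∀ x → (∀ {y} → y < x → Σ[ z ∈ C ] θ y z × LeastInClass z) →
           Σ[ z ∈ C ] θ x z × LeastInClass z
    step x ih with em {Σ[ y ∈ C ] y < x × θ y x}
    ... | yes (y , y<x , θyx) = Prod.map₂ (Prod.map₁ (θ.trans (θ.sym θyx))) (ih y<x)
    ... | no  ¬∃              = x , θ.refl , λ y y<x θyx → ¬∃ (y , y<x , θyx)

  leastInClass-unique : ∀ {x y} → LeastInClass x → LeastInClass y → θ x y → x ≈ y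
  leastInClass-unique {x} {y} lx ly θxy with compare x y
  ... | tri< x<y _ _ = contradiction θxy (ly x x<y)
  ... | tri≈ _ x≈y _ = x≈y
  ... | tri> _ _ y<x = contradiction (θ.sym θxy) (lx y y<x)

-- Finite conjunctions and blocks of quantifiers.

module _ {F R : Signature ℓ} where

  ⊤′ : Formula F R n
  ⊤′ = ⊥′ ⇒′ ⊥′

  ⋀ : (m : ℕ) → (Fin m → Formula F R n) → Formula F R n
  ⋀ zero    φ = ⊤′
  ⋀ (suc m) φ = head φ ∧′ ⋀ m (tail φ)

  -- Variable zero is bound innermost, so the variable counts agree by computation and no formula
  -- has to be transported.
  ∃* : (m : ℕ) → Formula F R (m + n) → Formula F R n
  ∃* zero    φ = φ
  ∃* (suc m) φ = ∃* m (∃′ φ)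

  module _ (A : Structure F R) where
    open Structure A using (reflexive)

    ⊨-⋀ : (φ : Fin m → Formula F R n) {ρ : Vector (Carrier A) n} →
          (∀ i → A ⊨ φ i [ ρ ]) ⇔ A ⊨ ⋀ m φ [ ρ ]
    ⊨-⋀ {m = zero}  φ = mk⇔ (λ _ → id) (λ _ ())
    ⊨-⋀ {m = suc m} φ = mk⇔
      (λ h → h zero , to (⊨-⋀ (tail φ)) (h ∘ suc))
      (λ { (p , q) zero → p ; (p , q) (suc i) → from (⊨-⋀ (tail φ)) q i })

    ⊨-∃* : (m : ℕ) (φ : Formula F R (m + n)) {ρ : Vector (Carrier A) n} →
           (Σ[ xs ∈ Vector (Carrier A) m ] A ⊨ φ [ xs ++ ρ ]) ⇔ A ⊨ ∃* m φ [ ρ ]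
    ⊨-∃* zero    φ = mk⇔ proj₂ ([] ,_)
    ⊨-∃* (suc m) φ {ρ} = mk⇔
      (λ (xs , p) → to (⊨-∃* m (∃′ φ))
        (tail xs , head xs , ⊨-resp-≋ A φ (reflexive ∘ ++-head-tail xs ρ) p))
      (λ q → let xs , x , p = from (⊨-∃* m (∃′ φ)) q in
        x ∷ xs , ⊨-resp-≋ A φ (λ i → reflexive (≡.sym (++-head-tail (x ∷ xs) ρ i))) p)

-- Translation of formulas from algebras to their graphs.

module _ {F : Signature ℓ} where

  -- `graph` reads the value of an operation from the last position, which is where `insertAt` at
  -- `fromℕ _` puts `j`.
  applyAt : (f : Symbol F) → Vector (Fin m) (arity F f) → Fin m →
            Formula ∅ (graphs F ∪<) m
  applyAt f is j = rel (base f) (λ i → var (insertAt is (fromℕ _) j i))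

  -- valueAt t r j says that t, with its variables renamed along r, has the
  -- value of variable j.
  valueAt : Term F n → Vector (Fin m) n → Fin m → Formula ∅ (graphs F ∪<) m
  valueAt         (var i)    r j = var (r i) ≐ var j
  valueAt {m = m} (app f ts) r j = ∃* k
    (⋀ k (λ i → valueAt (ts i) ((k ↑ʳ_) ∘ r) (i ↑ˡ m)) ∧′ applyAt f (_↑ˡ m) (k ↑ʳ j))
    where k = arity F f

  -- An equation becomes the existence of a common value. The renaming `r` allows the formula for
  -- the congruence to be placed at any four variables of the query.
  relationalise : Formula F ∅ n → Vector (Fin m) n → Formula ∅ (graphs F ∪<) m
  relationalise (s ≐ t)  r = ∃′ (valueAt s (suc ∘ r) zero ∧′ valueAt t (suc ∘ r) zero)
  relationalise ⊥′       r = ⊥′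
  relationalise (φ ∧′ ψ) r = relationalise φ r ∧′ relationalise ψ r
  relationalise (φ ∨′ ψ) r = relationalise φ r ∨′ relationalise ψ r
  relationalise (φ ⇒′ ψ) r = relationalise φ r ⇒′ relationalise ψ r
  relationalise (∀′ φ)   r = ∀′ (relationalise φ (zero ∷ suc ∘ r))
  relationalise (∃′ φ)   r = ∃′ (relationalise φ (zero ∷ suc ∘ r))

  module _ (A : Algebra F) (W : WellOrder (Structure.setoid A)) where
    open Structure A hiding (Carrier)

    private
      B : RelStructure (graphs F ∪<)
      B = graph A ⟨ W ⟩

    ⊨-applyAt : (f : Symbol F) (is : Vector (Fin m) (arity F f)) (j : Fin m)
                (σ : Vector (Carrier A) m) →
                ⟦ f ⟧ᶠ (σ ∘ is) ≈ σ j ⇔ B ⊨ applyAt f is j [ σ ]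
    ⊨-applyAt f is j σ = mk⇔
      (λ p → trans args (trans p (sym value)))
      (λ p → trans (sym args) (trans p value))
      where
      args  = fcong f (λ i → reflexive (≡.cong σ (insertAt-inject₁ is j i)))
      value = reflexive (≡.cong σ (insertAt-lookup is (fromℕ _) j))

    -- Induction on the term. The values of the immediate subterms witness the new variables;
    -- conversely, the induction hypothesis forces any witnesses to be equal to these values.
    ⊨-valueAt : (t : Term F n) (r : Vector (Fin m) n) (j : Fin m)
                {ρ : Vector (Carrier A) n} {σ : Vector (Carrier A) m} →
                (∀ i → ρ i ≈ σ (r i)) →
                eval A t ρ ≈ σ j ⇔ B ⊨ valueAt t r j [ σ ]
    ⊨-valueAt (var i) r j e = mk⇔ (trans (sym (e i))) (trans (e i))
    ⊨-valueAt {m = m} (app f ts) r j {ρ} {σ} e = mk⇔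
      (λ p → let vs = λ i → eval A (ts i) ρ in
        to (⊨-∃* B k _)
          (vs
          , to (⊨-⋀ B {m = k} _) (λ i → to (subterm vs i) (sym (argument vs i)))
          , to (⊨-applyAt f (_↑ˡ m) (k ↑ʳ j) (vs ++ σ))
              (trans (fcong f (argument vs)) (trans p (sym (variable′ vs j))))))
      (λ p → let vs , q , g = from (⊨-∃* B k _) p in
        trans (fcong f (λ i → from (subterm vs i) (from (⊨-⋀ B {m = k} _) q i)))
          (trans (from (⊨-applyAt f (_↑ˡ m) (k ↑ʳ j) (vs ++ σ)) g) (variable′ vs j)))
      where
      k = arity F f

      argument : (vs : Vector (Carrier A) k) (i : Fin k) → (vs ++ σ) (i ↑ˡ m) ≈ vs i
      argument vs i = reflexive (lookup-++ˡ vs σ i)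

      variable′ : (vs : Vector (Carrier A) k) (i : Fin m) → (vs ++ σ) (k ↑ʳ i) ≈ σ i
      variable′ vs i = reflexive (lookup-++ʳ vs σ i)

      subterm : (vs : Vector (Carrier A) k) (i : Fin k) →
                eval A (ts i) ρ ≈ (vs ++ σ) (i ↑ˡ m) ⇔
                B ⊨ valueAt (ts i) ((k ↑ʳ_) ∘ r) (i ↑ˡ m) [ vs ++ σ ]
      subterm vs i = ⊨-valueAt (ts i) _ _ (λ i → trans (e i) (sym (variable′ vs (r i))))

    -- An algebra and its graph have the same carrier, so connectives and quantifiers carry over
    -- directly and only equations need `⊨-valueAt`.
    ⊨-relationalise : (φ : Formula F ∅ n) (r : Vector (Fin m) n)
                      {ρ : Vector (Carrier A) n} {σ : Vector (Carrier A) m} →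
                      (∀ i → ρ i ≈ σ (r i)) →
                      A ⊨ φ [ ρ ] ⇔ B ⊨ relationalise φ r [ σ ]
    ⊨-relationalise (s ≐ t) r {ρ} e = mk⇔
      (λ p → eval A t ρ , to (⊨-valueAt s _ _ e) p , to (⊨-valueAt t _ _ e) refl)
      (λ (_ , p , q) → trans (from (⊨-valueAt s _ _ e) p) (sym (from (⊨-valueAt t _ _ e) q)))
    ⊨-relationalise ⊥′       r e = mk⇔ id id
    ⊨-relationalise (φ ∧′ ψ) r e = ⊨-relationalise φ r e ×-⇔ ⊨-relationalise ψ r e
    ⊨-relationalise (φ ∨′ ψ) r e = ⊨-relationalise φ r e ⊎-⇔ ⊨-relationalise ψ r e
    ⊨-relationalise (φ ⇒′ ψ) r e = →-cong-⇔ (⊨-relationalise φ r e) (⊨-relationalise ψ r e)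
    ⊨-relationalise (∀′ φ)   r e = mk⇔ (λ h x → to (ih x) (h x)) (λ h x → from (ih x) (h x))
      where ih = λ x → ⊨-relationalise φ (zero ∷ suc ∘ r) {ρ = x ∷ _}
                         (λ { zero → refl ; (suc i) → e i })
    ⊨-relationalise (∃′ φ)   r e = mk⇔ (Prod.map₂ (to (ih _))) (Prod.map₂ (from (ih _)))
      where ih = λ x → ⊨-relationalise φ (zero ∷ suc ∘ r) {ρ = x ∷ _}
                         (λ { zero → refl ; (suc i) → e i })

  -- Generated congruences and the monolith of the quotient.

  module _ (A : Algebra F) (a b : Carrier A) where
    open Structure A using (_≈_; ⟦_⟧ᶠ)

    -- An inductive closure stays at level `ℓ`, whereas the intersection of all congruences
    -- containing the pair would quantify over relations and leave it.
    data Generated : Rel (Carrier A) ℓ where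
      pair  : Generated a b
      refl  : ∀ {x y} → x ≈ y → Generated x y
      sym   : ∀ {x y} → Generated x y → Generated y x
      trans : ∀ {x y z} → Generated x y → Generated y z → Generated x z
      comp  : ∀ f {xs ys} → (∀ i → Generated (xs i) (ys i)) →
              Generated (⟦ f ⟧ᶠ xs) (⟦ f ⟧ᶠ ys)

    generated-least : ∀ ψ → IsCongruence A ψ → ψ a b → Generated ⇒ ψ
    generated-least ψ c ab = go
      where
      module ψ where
        open IsCongruence c public
        open IsEquivalence isEquivalence public using (sym; trans)

      go : Generated ⇒ ψ
      go pair        = ab
      go (refl e)    = ψ.reflexive e
      go (sym p)     = ψ.sym (go p)
      go (trans p q) = ψ.trans (go p) (go q)
      go (comp f ps) = ψ.compatible f (λ i → go (ps i))

    generated-isGeneratedBy : IsGeneratedBy A a b Generated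
    generated-isGeneratedBy = record
      { isCongruence = record
        { isEquivalence = record
          { refl = refl (Structure.refl A) ; sym = sym ; trans = trans }
        ; reflexive     = refl
        ; compatible    = comp
        }
      ; contains     = pair
      ; least        = generated-least
      }

  -- One direction of the correspondence theorem: the quotient keeps the carrier and the operations,
  -- and only its equality is coarser.
  lift-isCongruence : {A : Algebra F} {θ ψ : Rel (Carrier A) ℓ} (c : IsCongruence A θ) →
                      IsCongruence (A / c) ψ → IsCongruence A ψ
  lift-isCongruence c d = record
    { isEquivalence = D.isEquivalence
    ; reflexive     = D.reflexive ∘ IsCongruence.reflexive c
    ; compatible    = D.compatible
    }
    where module D = IsCongruence d

  maximalAvoiding⇒monolith :
    ExcludedMiddle ℓ → {A : Algebra F} {a b : Carrier A} {θ : Rel (Carrier A) ℓ} →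
    (mx : IsMaximalAvoiding A a b θ) →
    let A/θ = A / IsMaximalAvoiding.isCongruence mx in
    IsMonolith A/θ (Generated A/θ a b)
  maximalAvoiding⇒monolith em {A} {a} {b} mx = record
    { isCongruence = IsGeneratedBy.isCongruence (generated-isGeneratedBy (A / c) a b)
    -- Equality in the quotient is `θ`, so `avoids` says that `a` and `b` are distinct there.
    ; nontrivial   = a , b , pair , avoids
    ; minimum      = λ ψ d (x , y , ψxy , ¬θxy) → generated-least (A / c) a b ψ d
        -- If `ψ` avoided the pair, maximality would put it inside `θ`, although it relates `x` and
        -- `y`.
        (decidable-stable em λ ¬ψab →
          ¬θxy (maximal ψ (lift-isCongruence c d) ¬ψab (IsCongruence.reflexive d) ψxy))
    }
    where open IsMaximalAvoiding mx renaming (isCongruence to c)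

  -- The query of least representatives.

  -- Under the quantifier of leastRepresentatives, the parameters a and b are
  -- variables 1 and 2.
  related : Formula F ∅ 4 → Fin (3 + m) → Fin (3 + m) → Formula ∅ (graphs F ∪<) (3 + m)
  related π i j = relationalise π (suc zero ∷ suc (suc zero) ∷ i ∷ j ∷ [])

  -- The value of `f` on least representatives need not be least itself, so `relation` names it by a
  -- quantifier and relates it to the last entry through the congruence.
  leastRepresentatives : Formula F ∅ 4 → Query (graphs F) (graphs F) 2
  leastRepresentatives π = record
    { dim      = 1
    ; universe = ∀′ (rel less (var ∘ (zero ∷ suc x ∷ [])) ⇒′ related π zero (suc x) ⇒′ ⊥′)
    ; relation = λ f → ∃′ (applyAt f (λ i → suc (entry (inject₁ i))) zero ∧′
                           related π zero (suc (entry (fromℕ (arity F f)))))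
    }
    where
    x : Fin 3
    x = suc (suc zero)

    -- The two parameters come first, followed by blocks of length one.
    entry : {n : ℕ} → Fin n → Fin (2 + n * 1)
    entry i = 2 ↑ʳ combine i zero

  -- The isomorphism sends an element to the least representative of its class. Related elements
  -- share it by uniqueness; elements that share it are related, each being related to its
  -- representative.
  leastRepresentatives-defines :
    ExcludedMiddle ℓ → (π : Formula F ∅ 4) (A : Algebra F) (a b : Carrier A) →
    (c : IsCongruence A (λ x y → A ⊨ π [ a ∷ b ∷ x ∷ y ∷ [] ])) →
    (W : WellOrder (Structure.setoid A)) →
    Defines (leastRepresentatives π) A W (a ∷ b ∷ []) (A / c)
  leastRepresentatives-defines em π A a b c W = record
    { bijection = record
      { to        = λ x → (λ _ → rep x) , from (universe⇔least _) (rep-least x)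
      ; cong      = λ {x} {y} θxy _ → leastInClass-unique em W isEquivalence
                      (rep-least x) (rep-least y)
                      (θ.trans (θ.sym (θ-rep x)) (θ.trans θxy (θ-rep y)))
      ; bijective =
          (λ {x} {y} e → θ.trans (θ-rep x) (θ.trans (reflexive (e zero)) (θ.sym (θ-rep y))))
        -- A least element represents its own class, so it is its own preimage.
        , (λ (ys , p) → ys zero , λ {z} θzy → λ { zero →
            leastInClass-unique em W isEquivalence (rep-least z) (to (universe⇔least ys) p)
              (θ.trans (θ.sym (θ-rep z)) θzy) })
      }
    ; preserves = λ f xs →
        let σ : Vector (Carrier A) (2 + suc (arity F f) * 1)
            σ = as ++ concat (λ i (_ : Fin 1) → rep (xs i))

            -- `concat` finds an entry by division with remainder, so reading it back takes a proof.
            entry : ∀ i → concat (λ i (_ : Fin 1) → rep (xs i)) (combine i zero) A.≈ rep (xs i)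
            entry i = A.reflexive (lookup-concat (λ i (_ : Fin 1) → rep (xs i)) i zero)
        in mk⇔
          (λ p →
              -- By compatibility, passing to representatives changes the value only within its
              -- class.
              A.⟦ f ⟧ᶠ (rep ∘ xs ∘ inject₁)
            , to (⊨-applyAt A W f _ zero (_ ∷ σ)) (A.fcong f (entry ∘ inject₁))
            , to (⊨-related (_ ∷ σ) _ _)
                (θ.trans (compatible f (λ i → θ.sym (θ-rep (xs (inject₁ i)))))
                  (θ.trans p (θ.trans (θ-rep (xs (fromℕ (arity F f))))
                    (reflexive (A.sym (entry (fromℕ (arity F f)))))))))
          (λ (z , p , q) →
            θ.trans (compatible f (λ i → θ-rep (xs (inject₁ i))))
              (θ.trans (reflexive (A.trans (A.fcong f (A.sym ∘ entry ∘ inject₁))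
                                    (from (⊨-applyAt A W f _ zero (z ∷ σ)) p)))
                (θ.trans (from (⊨-related (z ∷ σ) _ _) q)
                  (θ.trans (reflexive (entry (fromℕ (arity F f))))
                    (θ.sym (θ-rep (xs (fromℕ (arity F f)))))))))
    }
    where
    module A = Structure A
    open IsCongruence c
    module θ = IsEquivalence isEquivalence

    as : Vector (Carrier A) 2
    as = a ∷ b ∷ []

    rep : Carrier A → Carrier A
    rep x = proj₁ (leastRepresentative em W isEquivalence x)

    θ-rep : ∀ x → A ⊨ π [ a ∷ b ∷ x ∷ rep x ∷ [] ]
    θ-rep x = proj₁ (proj₂ (leastRepresentative em W isEquivalence x))

    rep-least : ∀ x → LeastInClass em W isEquivalence (rep x)
    rep-least x = proj₂ (proj₂ (leastRepresentative em W isEquivalence x))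

    ⊨-related : ∀ {m} (σ : Vector (Carrier A) (3 + m)) (i j : Fin (3 + m)) →
                A ⊨ π [ σ (suc zero) ∷ σ (suc (suc zero)) ∷ σ i ∷ σ j ∷ [] ] ⇔
                graph A ⟨ W ⟩ ⊨ related π i j [ σ ]
    ⊨-related σ i j = ⊨-relationalise A W π _
      (λ { zero → A.refl ; (suc zero) → A.refl ; (suc (suc zero)) → A.refl
         ; (suc (suc (suc zero))) → A.refl })

    universe⇔least : (ys : Vector (Carrier A) 1) →
                     graph A ⟨ W ⟩ ⊨ Query.universe (leastRepresentatives π) [ as ++ ys ] ⇔
                     LeastInClass em W isEquivalence (ys zero)
    universe⇔least ys = mk⇔
      (λ p z z<y θzy → ⊥-elim (p z z<y (to (⊨-related (z ∷ (as ++ ys)) _ _) θzy)))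
      (λ l z z<y q → contradiction (from (⊨-related (z ∷ (as ++ ys)) _ _) q) (l z z<y))

theorem3p6 : {ℓ κ : Level} → ExcludedMiddle ℓ →
    (F : Signature ℓ) (K : Pred (Algebra F) κ) →
    ClosedUnderHomomorphicImages K →
    HasDefinableCMICongruences K →
    Σ[ φ ∈ Query (graphs F) (graphs F) 2 ]
    ((A : Algebra F) → K A →
    (a b : Structure.Carrier A) → ¬ Structure._≈_ A a b →
    Σ[ θ ∈ Rel (Structure.Carrier A) ℓ ]
    Σ[ c ∈ IsCongruence A θ ]
    Σ[ si ∈ SubdirectlyIrreducible (A / c) ]
    IsGeneratedBy (A / c) a b (monolith (A / c) si) ×
    ((W : WellOrder (Structure.setoid A)) → Defines φ A W (a ∷ b ∷ []) (A / c)))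
theorem3p6 em F K _ (π , definable) =
    leastRepresentatives π
  , λ A A∈K a b a≉b →
      let mx = definable A A∈K a b a≉b
          c  = IsMaximalAvoiding.isCongruence mx
      -- The relation left implicit is the one that `π` defines at `a` and `b`.
      in _ , c
       , (Generated (A / c) a b , maximalAvoiding⇒monolith em mx)
       , generated-isGeneratedBy (A / c) a b
       , leastRepresentatives-defines em π A a b c
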